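{- Let $j$ and $e$ be integers such that $j\ge 4$, $j\ne 6$, and $e\ge 1$. Then the sequence $\mathcal{F}^e(F_j)=(F_i^e \bmod F_j : i\ge 0)$ is periodic and its periodicity $\pi(F_j,e)$ is as follows. (i) Assume that $j$ is even. (i.1) If $e$ is even, then $\pi(F_j,e)=j$; (i.2) if $e$ is odd, then $\pi(F_j,e)=2j$. (ii) Assume that $j$ is odd. (ii.1) If $e\equiv 0\pmod 4$, then $\pi(F_j,e)=j$; (ii.2) if $e\equiv 2\pmod 4$, then $\pi(F_j,e)=2j$; (ii.3) if $e$ is odd, then $\pi(F_j,e)=4j$.
   Context: The Fibonacci numbers are $F_0=0$, $F_1=1$, $F_{i+1}=F_i+F_{i-1}$ for $i\ge 1$. For integers $j\ge 1$, $e\ge 1$, $\mathcal{F}^e(F_j)$ denotes the sequence $(F_i^e \bmod F_j : i\ge 0)$ of residues of $F_i^e$ modulo $F_j$. A sequence $(a_i:i\ge 0)$ is periodic if there is an integer $p\ge 1$, called a period, with $a_{i+p}=a_i$ for all $i\ge 0$. The periodicity $\pi(F_j,e)$ is the minimum period of $\mathcal{F}^e(F_j)$. -}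

module Defs where

open import Data.Nat using (ℕ; zero; suc; _+_; _^_; _%_; _≤_; NonZero)
open import Data.Product using (_×_; ∃)
open import Relation.Binary.PropositionalEquality using (_≡_)

fib : ℕ → ℕ
fib zero          = 0
fib (suc zero)    = 1
fib (suc (suc n)) = fib (suc n) + fib n

+-nonZeroˡ : ∀ m n → NonZero m → NonZero (m + n)
+-nonZeroˡ (suc _) _ _ = _

-- Not declared as an instance: instance search would loop on NonZero (fib ?j).
fib-nonZero : ∀ j .{{_ : NonZero j}} → NonZero (fib j)
fib-nonZero (suc zero)    = _
fib-nonZero (suc (suc n)) = +-nonZeroˡ (fib (suc n)) (fib n) (fib-nonZero (suc n))

-- 𝓕 e j is the sequence (F_i ^ e mod F_j : i ≥ 0); the second argument is the
-- index j, not the modulus F_j.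
𝓕 : (e j : ℕ) .{{_ : NonZero j}} → ℕ → ℕ
𝓕 e j i = (fib i ^ e % fib j) {{fib-nonZero j}}

IsPeriod : (ℕ → ℕ) → ℕ → Set
IsPeriod a p = 1 ≤ p × (∀ i → a (i + p) ≡ a i)

Periodic : (ℕ → ℕ) → Set
Periodic a = ∃ λ p → IsPeriod a p

-- A sequence has at most one minimum period, so "π(F_j , e) = p" is the
-- relation IsPeriodicity (𝓕 e j) p.
IsPeriodicity : (ℕ → ℕ) → ℕ → Set
IsPeriodicity a p = IsPeriod a p × (∀ q → IsPeriod a q → p ≤ q)

{-# OPTIONS --safe #-}
module Submission where

-- Modulo M = F_j the shift by j multiplies F_i by u = F_{j-1}, and Cassini gives
-- u² ≡ (-1)^j. So once every period q is known to be a multiple s·j of j, the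
-- periodicity is j times the order of u ^ e modulo M.
--
-- That j ∣ q: a period q satisfies M ∣ F_q ^ e, so every prime divisor of F_j
-- divides F_q, hence F_gcd(j,q). If j ∤ q then j = r g with r prime and F_j has the
-- same prime divisors as x = F_g. As F_{rg} / F_g ≡ r F_{g-1}^{r-1} modulo x, the
-- quotient is a power of r, r ∣ x. For odd r the expansion modulo x² shows that
-- r² does not divide it, so it is r, which is too small. For r = 2 it is the
-- Lucas number L_g, never divisible by 8, so L_g ≤ 4, which leaves only j = 6.

open import Defs
open import Data.Nat
open import Data.Nat.Properties
open import Data.Nat.Divisibility
open import Data.Nat.DivMod using (m≡m%n+[m/n]*n; m%n<n; m<n⇒m%n≡m;
  %-distribˡ-+; %-distribˡ-*; %-remove-+ˡ; %-remove-+ʳ)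
open import Data.Nat.GCD using (gcd; gcd[m,n]∣m; gcd[m,n]∣n; gcd-GCD; module Bézout)
open import Data.Nat.Primality
open import Data.Nat.Primality.Factorisation using (factorise)
open import Data.Nat.Tactic.RingSolver using (solve-∀)
open import Data.List.Base using ([]; _∷_)
open import Data.List.Relation.Unary.All using (_∷_)
open import Data.Empty using (⊥; ⊥-elim)
open import Data.Product using (_×_; _,_; ∃)
open import Data.Sum using (_⊎_; inj₁; inj₂)
open import Relation.Binary.PropositionalEquality
open import Relation.Nullary using (Dec; ¬_; yes; no; contradiction)
open import Relation.Nullary.Decidable using (from-yes; ¬?)

-- Prime divisors of numbers and of powers.

∃-prime-divisor : ∀ n .{{_ : NonZero n}} → n ≢ 1 → ∃ λ p → Prime p × p ∣ n
∃-prime-divisor n n≢1 with factorise n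
... | record { factors = []    ; isFactorisation = n≡1 }  = contradiction n≡1 n≢1
... | record { factors = p ∷ ps ; isFactorisation = n≡p*ps ; factorsPrime = pr ∷ _ } =
  p , pr , subst (p ∣_) (sym n≡p*ps) (m∣m*n _)

prime-∣-^ : ∀ {p} → Prime p → ∀ m n → p ∣ m ^ n → p ∣ m
prime-∣-^ pr m zero    p∣1 = contradiction (subst Prime (∣1⇒≡1 p∣1) pr) ¬prime[1]
prime-∣-^ pr m (suc n) p∣  with euclidsLemma m (m ^ n) pr p∣
... | inj₁ p∣m = p∣m
... | inj₂ p∣mⁿ = prime-∣-^ pr m n p∣mⁿ

prime-∣-prime : ∀ {p q} → Prime p → Prime q → p ∣ q → p ≡ q
prime-∣-prime pr qr p∣q with prime⇒irreducible qr p∣q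
... | inj₁ refl = contradiction pr ¬prime[1]
... | inj₂ p≡q  = p≡q

-- Addition formula and divisibility among Fibonacci numbers.

fib-+ : ∀ m n → fib (m + suc n) ≡ fib (suc m) * fib (suc n) + fib m * fib n
fib-+ zero    n = lemma (fib (suc n))
  where
  lemma : ∀ a → a ≡ 1 * a + 0
  lemma = solve-∀
fib-+ (suc m) n = trans (cong fib (sym (+-suc m (suc n))))
  (trans (fib-+ m (suc n)) (lemma (fib (suc m)) (fib m) (fib (suc n)) (fib n)))
  where
  lemma : ∀ a b c d → a * (c + d) + b * c ≡ (a + b) * c + a * d
  lemma = solve-∀

fib-≤-suc : ∀ n → fib n ≤ fib (suc n)
fib-≤-suc zero    = z≤n
fib-≤-suc (suc n) = m≤m+n (fib (suc n)) (fib n)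

fib-mono-≤′ : ∀ {m n} → m ≤′ n → fib m ≤ fib n
fib-mono-≤′ (≤′-reflexive refl) = ≤-refl
fib-mono-≤′ {m} {suc n} (≤′-step m≤n) = ≤-trans (fib-mono-≤′ m≤n) (fib-≤-suc n)

fib-mono-≤ : ∀ {m n} → m ≤ n → fib m ≤ fib n
fib-mono-≤ m≤n = fib-mono-≤′ (≤⇒≤′ m≤n)

¬prime-∣-consecutive-fib : ∀ {p} → Prime p → ∀ n → p ∣ fib n → ¬ p ∣ fib (suc n)
¬prime-∣-consecutive-fib pr zero    _  p∣1 = ¬prime[1] (subst Prime (∣1⇒≡1 p∣1) pr)
¬prime-∣-consecutive-fib pr (suc n) p∣ p∣′ =
  ¬prime-∣-consecutive-fib pr n (∣m+n∣m⇒∣n p∣′ p∣) p∣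

-- For positive `n` the addition formula leaves, modulo `p`, only `fib m` times the neighbour just
-- below `fib n`, and `p` cannot divide two consecutive Fibonacci numbers.
prime-∣-fib-cancelʳ : ∀ {p} → Prime p → ∀ m n → p ∣ fib (m + n) → p ∣ fib n → p ∣ fib m
prime-∣-fib-cancelʳ pr m zero p∣ _ = subst (λ k → _ ∣ fib k) (+-identityʳ m) p∣
prime-∣-fib-cancelʳ {p} pr m (suc n) p∣m+n p∣n
  with euclidsLemma (fib m) (fib n) pr
         (∣m+n∣m⇒∣n (subst (p ∣_) (fib-+ m n) p∣m+n) (∣n⇒∣m*n (fib (suc m)) p∣n))
... | inj₁ p∣m  = p∣m
... | inj₂ p∣n′ = contradiction p∣n (¬prime-∣-consecutive-fib pr n p∣n′)

-- fib-quotient h n = F_{n (h+1)} / F_{h+1}.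
fib-quotient : ℕ → ℕ → ℕ
fib-quotient h zero    = 0
fib-quotient h (suc n) = fib (suc (n * suc h)) + fib-quotient h n * fib h

fib-multiple : ∀ h n → fib (n * suc h) ≡ fib-quotient h n * fib (suc h)
fib-multiple h zero    = refl
fib-multiple h (suc n) = begin
  fib (suc h + n * suc h)                                ≡⟨ cong fib (+-comm (suc h) (n * suc h)) ⟩
  fib (n * suc h + suc h)                                ≡⟨ fib-+ (n * suc h) h ⟩
  fib (suc (n * suc h)) * fib (suc h) + fib (n * suc h) * fib h
    ≡⟨ cong (λ z → fib (suc (n * suc h)) * fib (suc h) + z * fib h) (fib-multiple h n) ⟩
  fib (suc (n * suc h)) * fib (suc h) + fib-quotient h n * fib (suc h) * fib h
    ≡⟨ lemma (fib (suc (n * suc h))) (fib (suc h)) (fib-quotient h n) (fib h) ⟩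
  fib-quotient h (suc n) * fib (suc h)                   ∎
  where
  open ≡-Reasoning
  lemma : ∀ c x q y → c * x + q * x * y ≡ (c + q * y) * x
  lemma = solve-∀

∣⇒fib-∣ : ∀ {m n} → m ∣ n → fib m ∣ fib n
∣⇒fib-∣ {zero}  {n} m∣n = subst (λ k → 0 ∣ fib k) (sym (0∣⇒≡0 m∣n)) ∣-refl
∣⇒fib-∣ {suc h} (divides-refl k) = divides (fib-quotient h k) (fib-multiple h k)

-- Bézout over the naturals writes the gcd plus a multiple of one index as a multiple of the other,
-- so a single cancellation replaces the Euclidean algorithm.
prime-∣-fib-gcd : ∀ {p} → Prime p → ∀ m n → p ∣ fib m → p ∣ fib n → p ∣ fib (gcd m n)
prime-∣-fib-gcd {p} pr m n p∣m p∣n with Bézout.identity (gcd-GCD m n)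
... | Bézout.+- x y eq = prime-∣-fib-cancelʳ pr (gcd m n) (y * n)
  (subst (λ k → p ∣ fib k) (sym eq) (∣-trans p∣m (∣⇒fib-∣ (n∣m*n x))))
  (∣-trans p∣n (∣⇒fib-∣ (n∣m*n y)))
... | Bézout.-+ x y eq = prime-∣-fib-cancelʳ pr (gcd m n) (x * m)
  (subst (λ k → p ∣ fib k) (sym eq) (∣-trans p∣n (∣⇒fib-∣ (n∣m*n y))))
  (∣-trans p∣m (∣⇒fib-∣ (n∣m*n x)))

-- Expansion of the Fibonacci quotient modulo the square of its divisor.

-- The terms linear in `x` in `fib-suc-multiple-expansion` have coefficients 0, 1, 2, and so on;
-- `fib-quotient-expansion` adds them up.
triangular : ℕ → ℕ
triangular zero    = 0
triangular (suc n) = suc n + triangular n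

2*triangular : ∀ n → 2 * triangular n ≡ n * suc n
2*triangular zero    = refl
2*triangular (suc n) = begin
  2 * (suc n + triangular n)       ≡⟨ *-distribˡ-+ 2 (suc n) (triangular n) ⟩
  2 * suc n + 2 * triangular n     ≡⟨ cong (2 * suc n +_) (2*triangular n) ⟩
  2 * suc n + n * suc n            ≡⟨ *-distribʳ-+ (suc n) 2 n ⟨
  suc (suc n) * suc n              ≡⟨ *-comm (suc (suc n)) (suc n) ⟩
  suc n * suc (suc n)              ∎
  where open ≡-Reasoning

module _ (h : ℕ) where

  private
    x y : ℕ
    x = fib (suc h)
    y = fib h

  -- Both expansions are multiplied by y = F_h to keep all exponents non-negative.
  fib-suc-multiple-expansion : ∀ n → ∃ λ c →
    fib (suc (n * suc h)) * y ≡ y * y ^ n + (n * x * y ^ n + x * x * c)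
  fib-suc-multiple-expansion zero    = 0 , lemma x y
    where
    lemma : ∀ x y → 1 * y ≡ y * 1 + (0 + x * x * 0)
    lemma = solve-∀
  fib-suc-multiple-expansion (suc n) with fib-suc-multiple-expansion n
  -- The witness collects what carries `x * x`: the linear term times the `x` of
  -- `fib (2 + h) = x + y`, the old remainder times `x + y`, and the quotient term.
  ... | c , eq = n * y ^ n + c * (x + y) + fib-quotient h n * y , (begin
    fib (suc (suc h + n * suc h)) * y
      ≡⟨ cong (λ k → fib (suc k) * y) (+-comm (suc h) (n * suc h)) ⟩
    fib (suc (n * suc h + suc h)) * y
      ≡⟨ cong (λ k → fib k * y) (+-suc (n * suc h) (suc h)) ⟨
    fib (n * suc h + suc (suc h)) * y
      ≡⟨ cong (_* y) (fib-+ (n * suc h) (suc h)) ⟩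
    (fib (suc (n * suc h)) * (x + y) + fib (n * suc h) * x) * y
      ≡⟨ cong (λ k → (fib (suc (n * suc h)) * (x + y) + k * x) * y) (fib-multiple h n) ⟩
    (fib (suc (n * suc h)) * (x + y) + fib-quotient h n * x * x) * y
      ≡⟨ lemma₁ (fib (suc (n * suc h))) x y (fib-quotient h n) ⟩
    fib (suc (n * suc h)) * y * (x + y) + fib-quotient h n * x * x * y
      ≡⟨ cong (λ k → k * (x + y) + fib-quotient h n * x * x * y) eq ⟩
    (y * y ^ n + (n * x * y ^ n + x * x * c)) * (x + y) + fib-quotient h n * x * x * y
      ≡⟨ lemma₂ n x y (y ^ n) (fib-quotient h n) c ⟩
    y * y ^ suc n + (suc n * x * y ^ suc n
      + x * x * (n * y ^ n + c * (x + y) + fib-quotient h n * y)) ∎)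
    where
    open ≡-Reasoning
    lemma₁ : ∀ a x y q → (a * (x + y) + q * x * x) * y ≡ a * y * (x + y) + q * x * x * y
    lemma₁ = solve-∀
    lemma₂ : ∀ n x y z q c →
      (y * z + (n * x * z + x * x * c)) * (x + y) + q * x * x * y
      ≡ y * (y * z) + ((1 + n) * x * (y * z) + x * x * (n * z + c * (x + y) + q * y))
    lemma₂ = solve-∀

  fib-quotient-expansion : ∀ n → ∃ λ a →
    y * fib-quotient h (suc n)
    ≡ suc n * y ^ suc n + (triangular n * x * y ^ n + x * x * a)
  fib-quotient-expansion zero    = 0 , lemma x y
    where
    lemma : ∀ x y → y * 1 ≡ 1 * (y * 1) + (0 + x * x * 0)
    lemma = solve-∀
  fib-quotient-expansion (suc n)
    with fib-suc-multiple-expansion (suc n) | fib-quotient-expansion n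
  ... | c , eq₁ | a , eq₂ = c + y * a , (begin
    y * (fib (suc (suc n * suc h)) + q * y)
      ≡⟨ lemma₁ (fib (suc (suc n * suc h))) y q ⟩
    fib (suc (suc n * suc h)) * y + (y * q) * y
      ≡⟨ cong₂ (λ k l → k + l * y) eq₁ eq₂ ⟩
    y * y ^ suc n + (suc n * x * y ^ suc n + x * x * c)
      + (suc n * y ^ suc n + (triangular n * x * y ^ n + x * x * a)) * y
      ≡⟨ lemma₂ n x y (y ^ n) (triangular n) a c ⟩
    suc (suc n) * y ^ suc (suc n)
      + (triangular (suc n) * x * y ^ suc n + x * x * (c + y * a)) ∎)
    where
    open ≡-Reasoning
    q = fib-quotient h (suc n)
    lemma₁ : ∀ d y q → y * (d + q * y) ≡ d * y + (y * q) * y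
    lemma₁ = solve-∀
    lemma₂ : ∀ n x y z t a c →
      y * (y * z) + ((1 + n) * x * (y * z) + x * x * c)
        + ((1 + n) * (y * z) + (t * x * z + x * x * a)) * y
      ≡ (2 + n) * (y * (y * z)) + ((1 + n + t) * x * (y * z) + x * x * (c + y * a))
    lemma₂ = solve-∀

  -- Modulo `p` only the leading term `suc n * y ^ suc n` of the expansion survives, and `p` cannot
  -- divide `y`, the neighbour of `x`.
  prime-∣-fib-quotient : ∀ {p n} → Prime p → p ∣ x → p ∣ fib-quotient h n → p ∣ n
  prime-∣-fib-quotient {n = zero}  pr p∣x p∣q = _ ∣0
  prime-∣-fib-quotient {p} {suc n} pr p∣x p∣q with fib-quotient-expansion n
  ... | a , eq with euclidsLemma (suc n) (y ^ suc n) pr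
                     (∣m+n∣m⇒∣n (subst (p ∣_) (trans eq (+-comm (suc n * y ^ suc n) (triangular n * x * y ^ n + x * x * a))) (∣n⇒∣m*n y p∣q))
                       (∣m∣n⇒∣m+n (∣m⇒∣m*n (y ^ n) (∣n⇒∣m*n (triangular n) p∣x))
                                  (∣m⇒∣m*n a (∣m⇒∣m*n x p∣x))))
  ...   | inj₁ p∣n = p∣n
  ...   | inj₂ p∣yⁿ =
    contradiction p∣x (¬prime-∣-consecutive-fib pr h (prime-∣-^ pr y (suc n) p∣yⁿ))

  -- For odd `r` the linear coefficient, the triangular number of `r - 1`, is a multiple of `r`.
  -- Modulo `r * r` only `r * y ^ r` remains, and cancelling one `r` would make `r` divide both `y`
  -- and `x`.
  oddPrime²∤fib-quotient : ∀ {r} → Prime r → r ≢ 2 → r ∣ x → r * r ∤ fib-quotient h r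
  oddPrime²∤fib-quotient {zero} pr = contradiction pr ¬prime[0]
  oddPrime²∤fib-quotient {r@(suc n)} pr r≢2 r∣x r²∣q with fib-quotient-expansion n
  ... | a , eq =
    ¬prime-∣-consecutive-fib pr h (prime-∣-^ pr y r (*-cancelˡ-∣ r r²∣ryʳ)) r∣x
    where
    r∣triangular : r ∣ triangular n
    r∣triangular with euclidsLemma 2 (triangular n) pr
                        (subst (r ∣_) (sym (2*triangular n)) (n∣m*n n))
    ... | inj₁ r∣2 = contradiction (prime-∣-prime pr prime[2] r∣2) r≢2
    ... | inj₂ r∣t = r∣t

    r²∣ryʳ : r * r ∣ r * y ^ r
    r²∣ryʳ = ∣m+n∣m⇒∣n (subst (r * r ∣_) (trans eq (+-comm (r * y ^ r) (triangular n * x * y ^ n + x * x * a))) (∣n⇒∣m*n y r²∣q))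
      (∣m∣n⇒∣m+n (∣m⇒∣m*n (y ^ n) (*-pres-∣ r∣triangular r∣x))
                 (∣m⇒∣m*n a (*-pres-∣ r∣x r∣x)))

-- Size of the quotient, and Lucas numbers modulo 8.

1≤fib-suc : ∀ n → 1 ≤ fib (suc n)
1≤fib-suc n = fib-mono-≤ {1} {suc n} (s≤s z≤n)

n≤fib-quotient : ∀ h n → n ≤ fib-quotient (suc h) n
n≤fib-quotient h zero    = z≤n
n≤fib-quotient h (suc n) = +-mono-≤ (1≤fib-suc (n * suc (suc h)))
  (≤-trans (n≤fib-quotient h n) (m≤m*n _ (fib (suc h)) {{>-nonZero (1≤fib-suc h)}}))

n<fib-quotient : ∀ h n → 2 ≤ n → n < fib-quotient (suc h) n
-- Strictness comes from the top summand alone: its index is at least 3, so it is at least 2.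
n<fib-quotient h (suc (suc n)) _ = +-mono-≤ (fib-mono-≤ {3} {suc (suc n * suc (suc h))} (s≤s (s≤s (s≤s z≤n))))
  (≤-trans (n≤fib-quotient h (suc n)) (m≤m*n _ (fib (suc h)) {{>-nonZero (1≤fib-suc h)}}))
n<fib-quotient h (suc zero) (s≤s ())

-- This sum is the Lucas number of index `suc n`. Modulo 8 it repeats after 12 steps, because
-- `fib 12 = 144 = 8 * 18` and `fib 11 = 89 = 8 * 11 + 1`, so twelve checks decide the matter.
8∤lucas : ∀ n → 8 ∤ fib (2 + n) + fib n
8∤lucas n 8∣ = below-12 (m%n<n n 12)
  (reduce (n % 12) (n / 12) (subst (λ k → 8 ∣ fib (2 + k) + fib k) (m≡m%n+[m/n]*n n 12) 8∣))
  where
  below-12 : ∀ {k} → k < 12 → 8 ∤ fib (2 + k) + fib k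
  below-12 = from-yes (allUpTo? (λ k → ¬? (8 ∣? (fib (2 + k) + fib k))) 12)

  shift : ∀ k → 8 ∣ fib (2 + (k + 12)) + fib (k + 12) → 8 ∣ fib (2 + k) + fib k
  shift k d = ∣m+n∣m⇒∣n (subst (8 ∣_) eq d)
    (m∣m*n (18 * fib (3 + k) + 11 * fib (2 + k) + 18 * fib (1 + k) + 11 * fib k))
    where
    lemma : ∀ a b c d →
      (a * 144 + b * 89) + (c * 144 + d * 89)
      ≡ 8 * (18 * a + 11 * b + 18 * c + 11 * d) + (b + d)
    lemma = solve-∀
    eq = trans (cong₂ _+_ (fib-+ (2 + k) 11) (fib-+ k 11))
               (lemma (fib (3 + k)) (fib (2 + k)) (fib (1 + k)) (fib k))

  reduce : ∀ r k → 8 ∣ fib (2 + (r + k * 12)) + fib (r + k * 12) → 8 ∣ fib (2 + r) + fib r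
  reduce r zero    d = subst (λ k → 8 ∣ fib (2 + k) + fib k) (+-identityʳ r) d
  reduce r (suc k) d = reduce r k (shift (r + k * 12)
    (subst (λ k → 8 ∣ fib (2 + k) + fib k)
      (trans (cong (r +_) (+-comm 12 (k * 12))) (sym (+-assoc r (k * 12) 12))) d))

-- Divisibility of indices from prime divisors.

-- The cofactor of `d` is not 1, so it has a prime divisor, necessarily `r`. Iterating from `d = 1`
-- extracts `r`, its square and its cube without naming an exponent.
primePower-step : ∀ {r n} .{{_ : NonZero n}} → (∀ {p} → Prime p → p ∣ n → p ≡ r) →
  ∀ {d} → d ∣ n → n ≢ d → r * d ∣ n
primePower-step {r} only {d} (divides-refl m) n≢d
  with ∃-prime-divisor m {{m*n≢0⇒m≢0 m}} (λ { refl → n≢d (*-identityˡ d) })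
... | p , pr , p∣m = *-monoˡ-∣ d (subst (_∣ m) (only pr (∣m⇒∣m*n d p∣m)) p∣m)

fib-quotient-2 : ∀ h → fib-quotient h 2 ≡ fib (2 + h) + fib h
fib-quotient-2 h = cong₂ (λ a b → fib (suc a) + b) (+-identityʳ (suc h)) (+-identityʳ (fib h))

-- A weak form of primitive divisors: the prime need only be new relative to the index `g`. The
-- index 6 is a genuine exception, as `fib 6 = 8` and `fib 3 = 2`.
fib-new-prime : ∀ {r g} → Prime r → 4 ≤ r * g → r * g ≢ 6 →
  ¬ (∀ {p} → Prime p → p ∣ fib (r * g) → p ∣ fib g)
fib-new-prime {r} {zero} pr 4≤ _ _ with () ← subst (4 ≤_) (*-zeroʳ r) 4≤
fib-new-prime {r} {suc h} pr 4≤j j≢6 old = go h refl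
  where
  3≤fib : 3 ≤ fib (r * suc h)
  3≤fib = fib-mono-≤ 4≤j

  fib≢1 : fib (suc h) ≢ 1
  fib≢1 fib≡1 with ∃-prime-divisor (fib (r * suc h)) {{>-nonZero (≤-trans (s≤s z≤n) 3≤fib)}}
                     (λ eq → contradiction (subst (3 ≤_) eq 3≤fib) λ { (s≤s ()) })
  ... | p , qr , p∣fib =
    ¬prime[1] (subst Prime (∣1⇒≡1 (subst (p ∣_) fib≡1 (old qr p∣fib))) qr)

  q : ℕ
  q = fib-quotient h r

  only : ∀ {p} → Prime p → p ∣ q → p ≡ r
  only {p} qr p∣q = prime-∣-prime qr pr (prime-∣-fib-quotient h qr p∣x p∣q)
    where
    p∣x : p ∣ fib (suc h)
    p∣x = old qr (subst (p ∣_) (sym (fib-multiple h r)) (∣m⇒∣m*n (fib (suc h)) p∣q))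

  1<r : 1 < r
  1<r = nonTrivial⇒n>1 r {{prime⇒nonTrivial pr}}

  module _ (r<q : r < q) where

    step : ∀ {d} → d ∣ q → q ≢ d → r * d ∣ q
    step = primePower-step {{>-nonZero (≤-trans (s≤s z≤n) r<q)}} only

    r∣q : r ∣ q
    r∣q = subst (_∣ q) (*-identityʳ r)
      (step (1∣ q) (λ q≡1 → <-asym 1<r (subst (r <_) q≡1 r<q)))

    r∣x : r ∣ fib (suc h)
    r∣x = old pr (subst (r ∣_) (sym (fib-multiple h r)) (∣m⇒∣m*n (fib (suc h)) r∣q))

    r*r∣q : r * r ∣ q
    r*r∣q = step r∣q (λ q≡r → <⇒≢ r<q (sym q≡r))

    odd-impossible : r ≢ 2 → ⊥
    odd-impossible r≢2 = oddPrime²∤fib-quotient h pr r≢2 r∣x r*r∣q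

    even-impossible : r ≡ 2 → q ≢ r * r → ⊥
    -- A third factor `r = 2` makes 8 divide the Lucas number `q`.
    even-impossible r≡2 q≢r² = 8∤lucas h (subst₂ _∣_ (cong (λ s → s * (s * s)) r≡2)
      (trans (cong (fib-quotient h) r≡2) (fib-quotient-2 h)) (step r*r∣q q≢r²))

  -- The values 0 and 1 of `h` are the indices 1 and 2, where `fib` is 1; beyond them the growth
  -- bound supplies `r < q`.
  go : ∀ k → h ≡ k → ⊥
  go 0 refl = fib≢1 refl
  go 1 refl = fib≢1 refl
  go (suc k@(suc l)) refl with r ≟ 2
  ... | no  r≢2  = odd-impossible (n<fib-quotient k r 1<r) r≢2
  ... | yes refl = even-impossible (n<fib-quotient k 2 1<r) refl (q≢4 l j≢6)
    where
    -- The quotient is the Lucas number of index `3 + l`: it equals 4 at `l = 0`, the excluded index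
    -- 6, and is at least `fib 5 = 5` afterwards.
    q≢4 : ∀ l → 2 * (3 + l) ≢ 6 → fib-quotient (2 + l) 2 ≢ 4
    q≢4 zero    6≢6 _ = 6≢6 refl
    q≢4 (suc l) _   q≡4 = <⇒≢ (≤-trans (fib-mono-≤ {5} {suc (1 * (4 + l))} (s≤s (s≤s (s≤s (s≤s (s≤s z≤n))))))
                               (m≤m+n (fib (suc (1 * (4 + l)))) (1 * fib (3 + l)))) (sym q≡4)

-- If the cofactor of the gcd in `j` is not 1, removing one prime `r` from it leaves an index that
-- the gcd still divides. All primes of `fib j` then already occur there, against `fib-new-prime`.
∣-index : ∀ {j q} → 4 ≤ j → j ≢ 6 → (∀ {p} → Prime p → p ∣ fib j → p ∣ fib q) → j ∣ q
∣-index {j} {q} 4≤j j≢6 old with gcd[m,n]∣m j q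
... | divides k j≡k*g with k ≟ 1
...   | yes refl = subst (_∣ q) (sym (trans j≡k*g (*-identityˡ _))) (gcd[m,n]∣n j q)
...   | no  k≢1
  with ∃-prime-divisor k {{≢-nonZero λ { refl → contradiction (subst (4 ≤_) j≡k*g 4≤j) λ () }}} k≢1
...     | r , pr , divides k′ refl = ⊥-elim
  (fib-new-prime pr (subst (4 ≤_) j≡r*g′ 4≤j) (λ eq → j≢6 (trans j≡r*g′ eq)) old′)
  where
  j≡r*g′ : j ≡ r * (k′ * gcd j q)
  j≡r*g′ = trans j≡k*g (trans (cong (_* gcd j q) (*-comm k′ r)) (*-assoc r k′ (gcd j q)))

  old′ : ∀ {p} → Prime p → p ∣ fib (r * (k′ * gcd j q)) → p ∣ fib (k′ * gcd j q)
  old′ {p} qr p∣ = ∣-trans (prime-∣-fib-gcd qr j q p∣j (old qr p∣j)) (∣⇒fib-∣ (n∣m*n k′))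
    where
    p∣j : p ∣ fib j
    p∣j = subst (λ i → p ∣ fib i) (sym j≡r*g′) p∣

-- Cassini's identity.

-- The product `fib k * fib (2 + k)` is expanded, and the parities are separated to avoid a negative
-- sign. Advancing the index by one turns either form into the other.
cassini-even : ∀ n → let k = n * 2 in
  fib k * fib k + fib k * fib (suc k) + 1 ≡ fib (suc k) * fib (suc k)
cassini-odd : ∀ n → let k = suc (n * 2) in
  fib k * fib k + fib k * fib (suc k) ≡ fib (suc k) * fib (suc k) + 1
cassini-even zero    = refl
cassini-even (suc n) = lemma (fib k) (fib (suc k)) (cassini-odd n)
  where
  k = suc (n * 2)
  lemma : ∀ a b → a * a + a * b ≡ b * b + 1 →
    b * b + b * (b + a) + 1 ≡ (b + a) * (b + a)
  lemma a b eq = trans (lemma₁ a b) (trans (cong (λ c → c + b * (b + a)) (sym eq)) (lemma₂ a b))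
    where
    lemma₁ : ∀ a b → b * b + b * (b + a) + 1 ≡ (b * b + 1) + b * (b + a)
    lemma₁ = solve-∀
    lemma₂ : ∀ a b → a * a + a * b + b * (b + a) ≡ (b + a) * (b + a)
    lemma₂ = solve-∀
cassini-odd n = lemma (fib k) (fib (suc k)) (cassini-even n)
  where
  k = n * 2
  lemma : ∀ a b → a * a + a * b + 1 ≡ b * b →
    b * b + b * (b + a) ≡ (b + a) * (b + a) + 1
  lemma a b eq = trans (cong (_+ b * (b + a)) (sym eq)) (lemma₁ a b)
    where
    lemma₁ : ∀ a b → a * a + a * b + 1 + b * (b + a) ≡ (b + a) * (b + a) + 1
    lemma₁ = solve-∀

-- Powers, parity and congruences.

^-distribʳ-* : ∀ e m n → (m * n) ^ e ≡ m ^ e * n ^ e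
^-distribʳ-* zero    m n = refl
^-distribʳ-* (suc e) m n = trans (cong (m * n *_) (^-distribʳ-* e m n))
  (lemma m n (m ^ e) (n ^ e))
  where
  lemma : ∀ a b c d → a * b * (c * d) ≡ a * c * (b * d)
  lemma = solve-∀

even-or-odd : ∀ n → ∃ λ m → n ≡ m * 2 ⊎ n ≡ suc (m * 2)
even-or-odd zero = 0 , inj₁ refl
even-or-odd (suc n) with even-or-odd n
... | m , inj₁ n≡ = m , inj₂ (cong suc n≡)
... | m , inj₂ n≡ = suc m , inj₁ (cong suc n≡)

2∤⇒odd : ∀ {n} → 2 ∤ n → ∃ λ m → n ≡ suc (m * 2)
2∤⇒odd {n} 2∤n with even-or-odd n
... | m , inj₁ n≡ = contradiction (divides m n≡) 2∤n
... | m , inj₂ n≡ = m , n≡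

module Congruence (M : ℕ) .{{_ : NonZero M}} where

  infix 4 _≈_

  _≈_ : ℕ → ℕ → Set
  a ≈ b = a % M ≡ b % M

  +-cong : ∀ {a b c d} → a ≈ b → c ≈ d → a + c ≈ b + d
  +-cong {a} {b} {c} {d} a≈b c≈d = trans (%-distribˡ-+ a c M)
    (trans (cong₂ (λ s t → (s + t) % M) a≈b c≈d) (sym (%-distribˡ-+ b d M)))

  *-cong : ∀ {a b c d} → a ≈ b → c ≈ d → a * c ≈ b * d
  *-cong {a} {b} {c} {d} a≈b c≈d = trans (%-distribˡ-* a c M)
    (trans (cong₂ (λ s t → (s * t) % M) a≈b c≈d) (sym (%-distribˡ-* b d M)))

  ^-cong : ∀ {a b} e → a ≈ b → a ^ e ≈ b ^ e
  ^-cong         zero    a≈b = refl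
  ^-cong {a} {b} (suc e) a≈b = *-cong {a} {b} {a ^ e} {b ^ e} a≈b (^-cong {a} {b} e a≈b)

  ^≈1-* : ∀ a d n → a ^ d ≈ 1 → a ^ (n * d) ≈ 1
  ^≈1-* a d n eq = trans (cong (λ k → a ^ k % M) (*-comm n d))
    (trans (cong (_% M) (sym (^-*-assoc a d n)))
      (trans (^-cong {a ^ d} {1} n eq) (cong (_% M) (^-zeroˡ n))))

  ^≈1-reduce : ∀ a d r n → a ^ d ≈ 1 → a ^ (r + n * d) ≈ a ^ r
  ^≈1-reduce a d r n eq = trans (cong (_% M) (^-distribˡ-+-* a r (n * d)))
    (trans (*-cong {a ^ r} {a ^ r} {a ^ (n * d)} {1} refl (^≈1-* a d n eq))
      (cong (_% M) (*-identityʳ (a ^ r))))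

-- Shifting the index by `j` modulo `fib j`.

module _ (k : ℕ) where

  private
    j M u : ℕ
    j = suc k
    M = fib j
    u = fib k
    instance
      M≢0 : NonZero M
      M≢0 = fib-nonZero j

  open Congruence M

  -- For each added `j`, the addition formula gives one term with factor `M`, which vanishes, and
  -- one with factor `u`.
  fib-shift : ∀ i s → fib (i + s * j) ≈ fib i * u ^ s
  fib-shift i zero    =
    cong (_% M) (trans (cong fib (+-identityʳ i)) (sym (*-identityʳ (fib i))))
  fib-shift i (suc s) = begin
    fib (i + (j + s * j)) % M       ≡⟨ cong (λ n → fib n % M) (lemma i j (s * j)) ⟩
    fib (i + s * j + j) % M         ≡⟨ cong (_% M) (fib-+ (i + s * j) k) ⟩
    (fib (suc (i + s * j)) * M + fib (i + s * j) * u) % M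
      ≡⟨ %-remove-+ˡ (fib (i + s * j) * u) (n∣m*n (fib (suc (i + s * j)))) ⟩
    (fib (i + s * j) * u) % M       ≡⟨ *-cong {fib (i + s * j)} {fib i * u ^ s} {u} {u} (fib-shift i s) refl ⟩
    (fib i * u ^ s * u) % M         ≡⟨ cong (_% M) (lemma₂ (fib i) (u ^ s) u) ⟩
    (fib i * u ^ suc s) % M         ∎
    where
    open ≡-Reasoning
    lemma : ∀ i j t → i + (j + t) ≡ i + t + j
    lemma = solve-∀
    lemma₂ : ∀ a b c → a * b * c ≡ a * (c * b)
    lemma₂ = solve-∀

  𝓕-shift : ∀ e i s → 𝓕 e j (i + s * j) ≡ (fib i ^ e * u ^ (s * e)) % M
  𝓕-shift e i s = trans (^-cong {fib (i + s * j)} {fib i * u ^ s} e (fib-shift i s))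
    (cong (_% M) (trans (^-distribʳ-* e (fib i) (u ^ s))
      (cong (fib i ^ e *_) (^-*-assoc u s e))))

  isPeriod-multiple : ∀ {e d} → 1 ≤ d → u ^ (d * e) ≈ 1 → IsPeriod (𝓕 e j) (d * j)
  isPeriod-multiple {e} {d} 1≤d eq = *-mono-≤ 1≤d (s≤s z≤n) , λ i →
    trans (𝓕-shift e i d)
      (trans (*-cong {fib i ^ e} {fib i ^ e} {u ^ (d * e)} {1} refl eq)
        (cong (_% M) (*-identityʳ (fib i ^ e))))

  -- Minimal periods as multiplicative orders.

  module _ (4≤j : 4 ≤ j) (j≢6 : j ≢ 6) where

    2≤u : 2 ≤ u
    2≤u = fib-mono-≤ {3} {k} (s≤s⁻¹ 4≤j)

    3≤M : 3 ≤ M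
    3≤M = fib-mono-≤ {4} {j} 4≤j

    -- Two indices suffice: the index 0 makes `M` divide `fib q ^ e`, which feeds `∣-index`, and the
    -- index 1 isolates the power of `u`.
    period⇒multiple : ∀ {e q} → 1 ≤ e → IsPeriod (𝓕 e j) q →
      ∃ λ s → q ≡ s * j × 1 ≤ s × u ^ (s * e) ≈ 1
    -- Exposing `e` as a successor lets `fib 0 ^ e` reduce to 0.
    period⇒multiple {e@(suc e′)} {q} _ (1≤q , per) with ∣-index {j} {q} 4≤j j≢6
      (λ pr p∣M → prime-∣-^ pr (fib q) e (∣-trans p∣M (m%n≡0⇒n∣m (fib q ^ e) M (trans (per 0) (n∣m⇒m%n≡0 0 M (M ∣0))))))
    ... | divides zero    refl = contradiction 1≤q λ ()
    ... | divides (suc s) refl = suc s , refl , s≤s z≤n , (begin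
      u ^ (suc s * e) % M               ≡⟨ cong (_% M) (*-identityˡ (u ^ (suc s * e))) ⟨
      (1 * u ^ (suc s * e)) % M         ≡⟨ cong (λ a → (a * u ^ (suc s * e)) % M) (^-zeroˡ e) ⟨
      (1 ^ e * u ^ (suc s * e)) % M     ≡⟨ 𝓕-shift e 1 (suc s) ⟨
      𝓕 e j (1 + suc s * j)             ≡⟨ per 1 ⟩
      1 ^ e % M                         ≡⟨ cong (_% M) (^-zeroˡ e) ⟩
      1 % M                             ∎)
      where open ≡-Reasoning

    -- The hypotheses make `d` the multiplicative order of `u ^ e` modulo `M`.
    isPeriodicity-order : ∀ {e} d → 1 ≤ e → 1 ≤ d → u ^ (d * e) ≈ 1 →
      (∀ s → 1 ≤ s → u ^ (s * e) ≈ 1 → d ≤ s) → IsPeriodicity (𝓕 e j) (d * j)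
    isPeriodicity-order {e} d 1≤e 1≤d eq least = isPeriod-multiple {e} {d} 1≤d eq , minimal
      where
      minimal : ∀ q → IsPeriod (𝓕 e j) q → d * j ≤ q
      minimal q per with period⇒multiple {e} {q} 1≤e per
      ... | s , refl , 1≤s , eq′ = *-monoˡ-≤ j (least s 1≤s eq′)

    isPeriodicity-1 : ∀ {e} → 1 ≤ e → u ^ e ≈ 1 → IsPeriodicity (𝓕 e j) j
    isPeriodicity-1 {e} 1≤e eq = subst (IsPeriodicity (𝓕 e j)) (*-identityˡ j)
      (isPeriodicity-order {e} 1 1≤e ≤-refl (trans (cong (λ n → u ^ n % M) (*-identityˡ e)) eq)
        (λ _ 1≤s _ → 1≤s))

    -- Both sides lie below `M`, so the congruence would be an equality, while `u` is at least 2.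
    u≉1 : ¬ u ≈ 1
    u≉1 eq = contradiction (trans (sym (m<n⇒m%n≡m u<M))
        (trans eq (m<n⇒m%n≡m (≤-trans (s≤s (s≤s z≤n)) 3≤M))))
      (λ u≡1 → <⇒≢ 2≤u (sym u≡1))
      where
      fib-<-suc : ∀ k → 3 ≤ k → fib k < fib (suc k)
      fib-<-suc (suc k@(suc l)) _ = subst (_≤ fib (suc k) + fib k) (+-comm (fib (suc k)) 1)
        (+-monoʳ-≤ (fib (suc k)) (1≤fib-suc l))
      fib-<-suc (suc zero) (s≤s ())
      u<M : u < M
      u<M = fib-<-suc k (s≤s⁻¹ 4≤j)

    -- Even `j`: the order of `u` is 2.

    module _ (2∣j : 2 ∣ j) where

      -- Cassini's identity at the odd index `k`, with both multiples of `M` dropped.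
      u²≈1 : u ^ 2 ≈ 1
      u²≈1 = sym (begin
        1 % M                      ≡⟨ %-remove-+ˡ 1 (n∣m*n M) ⟨
        (M * M + 1) % M            ≡⟨ cong (_% M) (cassini 2∣j) ⟨
        (u * u + u * M) % M        ≡⟨ %-remove-+ʳ (u * u) (n∣m*n u) ⟩
        (u * u) % M                ≡⟨ cong (λ a → (u * a) % M) (*-identityʳ u) ⟨
        u ^ 2 % M                  ∎)
        where
        open ≡-Reasoning
        cassini : 2 ∣ j → u * u + u * M ≡ M * M + 1
        cassini (divides (suc n) j≡) =
          subst (λ i → fib i * fib i + fib i * fib (suc i) ≡ fib (suc i) * fib (suc i) + 1)
            (sym (suc-injective j≡)) (cassini-odd n)

      even-even : ∀ {e} → 1 ≤ e → 2 ∣ e → IsPeriodicity (𝓕 e j) j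
      even-even 1≤e (divides-refl m) = isPeriodicity-1 1≤e (^≈1-* u 2 m u²≈1)

      even-odd : ∀ {e} → 1 ≤ e → 2 ∤ e → IsPeriodicity (𝓕 e j) (2 * j)
      even-odd {e} 1≤e 2∤e = isPeriodicity-order {e} 2 1≤e (s≤s z≤n)
        (trans (cong (λ n → u ^ n % M) (*-comm 2 e)) (^≈1-* u 2 e u²≈1)) least
        where
        least : ∀ s → 1 ≤ s → u ^ (s * e) ≈ 1 → 2 ≤ s
        least (suc (suc s)) _ _  = s≤s (s≤s z≤n)
        -- Since `u ^ 2` is 1, an odd power of `u` collapses to `u` itself.
        least 1             _ eq with 2∤⇒odd 2∤e
        ... | m , refl = contradiction (begin
          u % M                    ≡⟨ cong (_% M) (*-identityʳ u) ⟨
          u ^ 1 % M                ≡⟨ ^≈1-reduce u 2 1 m u²≈1 ⟨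
          u ^ (1 + m * 2) % M      ≡⟨ cong (λ n → u ^ n % M) (*-identityˡ (1 + m * 2)) ⟨
          u ^ (1 * (1 + m * 2)) % M ≡⟨ eq ⟩
          1 % M                    ∎) u≉1
          where open ≡-Reasoning

    -- Odd `j`: the order of `u` is 4.

    module _ (2∤j : 2 ∤ j) where

      -- Cassini's identity at the even index `k`; this expresses that the square of `u` is -1 while
      -- staying in the naturals.
      M∣u²+1 : M ∣ u ^ 2 + 1
      M∣u²+1 = ∣m+n∣m⇒∣n (subst (M ∣_) (trans (sym (cassini (2∤⇒odd 2∤j))) (lemma u M)) (n∣m*n M))
                         (n∣m*n u)
        where
        cassini : (∃ λ n → j ≡ suc (n * 2)) → u * u + u * M + 1 ≡ M * M
        cassini (n , j≡) =
          subst (λ i → fib i * fib i + fib i * fib (suc i) + 1 ≡ fib (suc i) * fib (suc i))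
            (sym (suc-injective j≡)) (cassini-even n)
        lemma : ∀ u M → u * u + u * M + 1 ≡ u * M + (u * (u * 1) + 1)
        lemma = solve-∀

      u⁴≈1 : u ^ 4 ≈ 1
      u⁴≈1 = begin
        -- Adding the multiple `u ^ 2 + 1` of `M` makes a factorisation possible without
        -- subtraction.
        u ^ 4 % M                      ≡⟨ %-remove-+ʳ (u ^ 4) M∣u²+1 ⟨
        (u ^ 4 + (u ^ 2 + 1)) % M      ≡⟨ cong (_% M) (lemma u) ⟩
        (u ^ 2 * (u ^ 2 + 1) + 1) % M  ≡⟨ %-remove-+ˡ 1 (∣n⇒∣m*n (u ^ 2) M∣u²+1) ⟩
        1 % M                          ∎
        where
        open ≡-Reasoning
        lemma : ∀ u → u * (u * (u * (u * 1))) + (u * (u * 1) + 1)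
                      ≡ u * (u * 1) * (u * (u * 1) + 1) + 1
        lemma = solve-∀

      -- Otherwise `u ^ 2 + 1` would be congruent to both 2 and 0, so `M` would divide 2.
      u²≉1 : ¬ u ^ 2 ≈ 1
      u²≉1 eq = <⇒≱ 3≤M (∣⇒≤ (m%n≡0⇒n∣m 2 M
        (trans (sym (+-cong {u ^ 2} {1} {1} {1} eq refl)) (n∣m⇒m%n≡0 (u ^ 2 + 1) M M∣u²+1))))

      -- Exponents matter only modulo 4. The lower bounds on the orders 2 and 4 for odd `j` all come
      -- down to this.
      ≡2-mod-4⇒^≉1 : ∀ {n} t → n ≡ 2 + t * 4 → ¬ u ^ n ≈ 1
      ≡2-mod-4⇒^≉1 t refl eq = u²≉1 (trans (sym (^≈1-reduce u 4 2 t u⁴≈1)) eq)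

      odd-0 : ∀ {e} → 1 ≤ e → e % 4 ≡ 0 → IsPeriodicity (𝓕 e j) j
      odd-0 {e} 1≤e e%4≡0 with m%n≡0⇒n∣m e 4 e%4≡0
      ... | divides-refl t = isPeriodicity-1 1≤e (^≈1-* u 4 t u⁴≈1)

      odd-2 : ∀ {e} → 1 ≤ e → e % 4 ≡ 2 → IsPeriodicity (𝓕 e j) (2 * j)
      odd-2 {e} 1≤e e%4≡2 = isPeriodicity-order {e} 2 1≤e (s≤s z≤n)
        (trans (cong (λ n → u ^ n % M) 2e≡) (^≈1-* u 4 (1 + t * 2) u⁴≈1)) least
        where
        t = e / 4
        e≡ : e ≡ 2 + t * 4
        e≡ = trans (m≡m%n+[m/n]*n e 4) (cong (_+ t * 4) e%4≡2)
        lemma : ∀ t → 2 * (2 + t * 4) ≡ (1 + t * 2) * 4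
        lemma = solve-∀
        2e≡ : 2 * e ≡ (1 + t * 2) * 4
        2e≡ = trans (cong (2 *_) e≡) (lemma t)
        least : ∀ s → 1 ≤ s → u ^ (s * e) ≈ 1 → 2 ≤ s
        least (suc (suc s)) _ _  = s≤s (s≤s z≤n)
        least 1             _ eq = contradiction eq
          (≡2-mod-4⇒^≉1 t (trans (*-identityˡ e) e≡))

      odd-odd : ∀ {e} → 1 ≤ e → 2 ∤ e → IsPeriodicity (𝓕 e j) (4 * j)
      odd-odd {e} 1≤e 2∤e with 2∤⇒odd 2∤e
      ... | m , refl = isPeriodicity-order {e} 4 1≤e (s≤s z≤n)
        (trans (cong (λ n → u ^ n % M) (*-comm 4 e)) (^≈1-* u 4 e u⁴≈1)) least
        where
        lemma₁ : ∀ m → 2 * (1 * (1 + m * 2)) ≡ 2 + m * 4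
        lemma₁ = solve-∀
        lemma₂ : ∀ m → 2 * (1 + m * 2) ≡ 2 + m * 4
        lemma₂ = solve-∀
        lemma₃ : ∀ m → 2 * (3 * (1 + m * 2)) ≡ 2 + (1 + 3 * m) * 4
        lemma₃ = solve-∀
        least : ∀ s → 1 ≤ s → u ^ (s * suc (m * 2)) ≈ 1 → 4 ≤ s
        least (suc (suc (suc (suc s)))) _ _ = s≤s (s≤s (s≤s (s≤s z≤n)))
        -- For `s` equal to 1 or 3 the exponent is odd, so the congruence is squared first to reach
        -- an exponent that is 2 modulo 4.
        least 1 _ eq = contradiction (^≈1-* u (1 * e) 2 eq) (≡2-mod-4⇒^≉1 m (lemma₁ m))
        least 2 _ eq = contradiction eq (≡2-mod-4⇒^≉1 m (lemma₂ m))
        least 3 _ eq = contradiction (^≈1-* u (3 * e) 2 eq) (≡2-mod-4⇒^≉1 (1 + 3 * m) (lemma₃ m))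

-- Existence of a period, and the minimal period in each of the five cases.

theorem7 : (j e : ℕ) .{{_ : NonZero j}} → 4 ≤ j → j ≢ 6 → 1 ≤ e →
    Periodic (𝓕 e j)
    × (2 ∣ j →
    (2 ∣ e → IsPeriodicity (𝓕 e j) j)
    × (2 ∤ e → IsPeriodicity (𝓕 e j) (2 * j)))
    × (2 ∤ j →
    (e % 4 ≡ 0 → IsPeriodicity (𝓕 e j) j)
    × (e % 4 ≡ 2 → IsPeriodicity (𝓕 e j) (2 * j))
    × (2 ∤ e → IsPeriodicity (𝓕 e j) (4 * j)))
theorem7 (suc k) e 4≤j j≢6 1≤e =
    -- The order of `u` divides 4 for either parity of the index, so four shifts give a period for
    -- every exponent.
    (4 * suc k , isPeriod-multiple k {e} {4} (s≤s z≤n) (^≈1-4 (2 ∣? suc k)))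
  , (λ 2∣j → even-even k 4≤j j≢6 2∣j 1≤e , even-odd k 4≤j j≢6 2∣j 1≤e)
  , (λ 2∤j → odd-0 k 4≤j j≢6 2∤j 1≤e , odd-2 k 4≤j j≢6 2∤j 1≤e , odd-odd k 4≤j j≢6 2∤j 1≤e)
  where
  instance
    M≢0 : NonZero (fib (suc k))
    M≢0 = fib-nonZero (suc k)
  open Congruence (fib (suc k))

  ^≈1-4 : Dec (2 ∣ suc k) → fib k ^ (4 * e) ≈ 1
  ^≈1-4 (yes 2∣j) = trans (cong (λ n → fib k ^ n % fib (suc k)) (lemma e))
    (^≈1-* (fib k) 2 (2 * e) (u²≈1 k 4≤j j≢6 2∣j))
    where
    lemma : ∀ e → 4 * e ≡ 2 * e * 2
    lemma = solve-∀
  ^≈1-4 (no 2∤j) = trans (cong (λ n → fib k ^ n % fib (suc k)) (*-comm 4 e))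
    (^≈1-* (fib k) 4 e (u⁴≈1 k 4≤j j≢6 2∤j))
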